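{- Let $G$ be a connected graph with $\chi(G)=k\ge 3$. Suppose $\mathscr C_0$ is an extendable coloring of $G[S]$ for some $S\subset V(G)$. If there is a pendant vertex $v$ of $G$ with $v\notin S$, then $\mathscr C_0$ is not a Sudoku coloring of $G$.
   Context: Graphs are finite, undirected and simple. A pendant vertex is a vertex of degree $1$. Let $G=(V,E)$ be a connected graph with chromatic number $\chi(G)=k\ge 2$. For $S\subset V$, let $\mathscr C_0$ be a proper coloring of the induced subgraph $G[S]$ with colors from $\{1,\dots,k\}$ (not all colors need be used). An extension of $\mathscr C_0$ is a proper $k$-coloring $V\to\{1,\dots,k\}$ of $G$ whose restriction to $S$ is $\mathscr C_0$. $\mathscr C_0$ is extendable if it has at least one extension, and is a Sudoku coloring of $G$ if it has exactly one extension. -}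

module Defs where

open import Data.Fin.Base using (Fin)
open import Data.Fin.Subset using (Subset; _∈_; ∣_∣)
open import Data.Nat.Base using (ℕ; _≤_)
open import Data.Product using (∃; ∃!; _×_; _,_; proj₁)
open import Data.Vec.Base using (tabulate)
open import Function.Base using (_on_)
open import Level using (0ℓ)
open import Relation.Binary.Construct.Closure.ReflexiveTransitive using (Star)
open import Relation.Binary.Core using (Rel)
open import Relation.Binary.Definitions using (Decidable; Symmetric; Irreflexive)
open import Relation.Binary.PropositionalEquality using (_≡_; _≢_; _≗_; cong)
open import Relation.Nullary.Decidable using (does)

-- Finiteness is imposed where needed by taking V = Fin n; a general vertex
-- type lets the induced subgraph be a graph on the subtype given by S.
record Graph (V : Set) : Set₁ where
  field
    Adj    : Rel V 0ℓ
    adj?   : Decidable Adj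
    symm   : Symmetric Adj
    irrefl : Irreflexive _≡_ Adj

open Graph public

Connected : {V : Set} → Graph V → Set
Connected G = ∀ x y → Star (Adj G) x y

neighbourhood : ∀ {n} → Graph (Fin n) → Fin n → Subset n
neighbourhood G v = tabulate (λ w → does (adj? G v w))

degree : ∀ {n} → Graph (Fin n) → Fin n → ℕ
degree G v = ∣ neighbourhood G v ∣

Pendant : ∀ {n} → Graph (Fin n) → Fin n → Set
Pendant G v = degree G v ≡ 1

infix 8 _[_]

_[_] : ∀ {n} → Graph (Fin n) → (S : Subset n) → Graph (∃ λ v → v ∈ S)
Adj    (G [ S ])     = Adj G on proj₁
adj?   (G [ S ]) x y = adj? G (proj₁ x) (proj₁ y)
symm   (G [ S ])     = symm G
irrefl (G [ S ]) eq  = irrefl G (cong proj₁ eq)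

-- The colours 1, …, k are represented by Fin k.
Coloring : Set → ℕ → Set
Coloring V k = V → Fin k

Proper : ∀ {V k} → Graph V → Coloring V k → Set
Proper G c = ∀ {x y} → Adj G x y → c x ≢ c y

Colorable : {V : Set} → Graph V → ℕ → Set
Colorable {V} G k = ∃ λ (c : Coloring V k) → Proper G c

-- χ(G) = k
IsChromaticNumber : {V : Set} → Graph V → ℕ → Set
IsChromaticNumber G k = Colorable G k × (∀ m → Colorable G m → k ≤ m)

module _ {n k} (G : Graph (Fin n)) (S : Subset n)
         (C₀ : Coloring (∃ λ v → v ∈ S) k) where

  IsExtension : Coloring (Fin n) k → Set
  IsExtension C = Proper G C × (∀ v (v∈S : v ∈ S) → C v ≡ C₀ (v , v∈S))

  Extendable : Set
  Extendable = ∃ IsExtension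

  -- Uniqueness is up to pointwise equality, i.e. equality of colourings as
  -- functions, since function extensionality is not available.
  IsSudoku : Set
  IsSudoku = Proper (G [ S ]) C₀ × ∃! _≗_ IsExtension

{-# OPTIONS --safe #-}

-- A pendant vertex v outside S has a single neighbour w, so among three or more
-- colours some colour differs from those of v and w.  Recolouring v with it
-- turns any extension into a different one.
module Submission where

open import Defs
open import Data.Nat.Base using (ℕ; _≤_; s≤s)
open import Data.Nat.Properties using (suc-injective; m<n⇒n≢0)
open import Data.Fin.Base using (Fin; zero; suc; punchIn; punchOut)
open import Data.Fin.Properties
  using (_≟_; punchInᵢ≢i; punchIn-injective; punchIn-punchOut)
open import Data.Fin.Subset using (Subset; _∈_; _∉_; ∣_∣; inside; outside)
open import Data.Fin.Subset.Properties using (x∈p⇒∣p-x∣<∣p∣)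
open import Data.Product using (∃; _×_; _,_)
open import Data.Vec.Base using (_∷_; here; there)
open import Data.Vec.Functional using (updateAt)
open import Data.Vec.Functional.Properties using (updateAt-updates; updateAt-minimal)
open import Data.Vec.Properties using (lookup∘tabulate; lookup⇒[]=)
open import Function.Base using (const)
open import Relation.Binary.PropositionalEquality
  using (_≡_; _≢_; refl; sym; trans; cong; subst)
open import Relation.Nullary using (¬_; yes; no; contradiction)
open import Relation.Nullary.Decidable using (dec-true)

∣p∣≡1⇒∃-unique : ∀ {n} (p : Subset n) → ∣ p ∣ ≡ 1 → ∃ λ w → ∀ {x} → x ∈ p → x ≡ w
∣p∣≡1⇒∃-unique (outside ∷ p) ∣p∣≡1 with w , unique ← ∣p∣≡1⇒∃-unique p ∣p∣≡1 =
  suc w , λ { (there x∈p) → cong suc (unique x∈p) }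
∣p∣≡1⇒∃-unique (inside ∷ p) ∣p∣≡1 = zero , λ
  { here        → refl
  ; (there x∈p) →
      -- The tail has size 0, yet deleting its member `x` would strictly lower that size.
      contradiction (suc-injective ∣p∣≡1) (m<n⇒n≢0 (x∈p⇒∣p-x∣<∣p∣ x∈p))
  }

pendant⇒∃-unique-neighbour : ∀ {n} (G : Graph (Fin n)) {v} → Pendant G v →
  ∃ λ w → ∀ {x} → Adj G v x → x ≡ w
pendant⇒∃-unique-neighbour G {v} pendant
  with w , unique ← ∣p∣≡1⇒∃-unique (neighbourhood G v) pendant =
  -- An edge makes the Boolean `does (adj? G v x)` true, that is `inside`, so `x` lies in the
  -- tabulated subset.
  w , λ {x} v~x → unique (lookup⇒[]= x _
        (trans (lookup∘tabulate _ x) (dec-true (adj? G v x) v~x)))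

-- `punchIn a` enumerates the colours other than `a`. Skipping in turn the position of `b` in that
-- enumeration still leaves one, since `k` is at least 3.
∃-third : ∀ {k} → 3 ≤ k → (a b : Fin k) → ∃ λ c → c ≢ a × c ≢ b
∃-third (s≤s (s≤s (s≤s _))) a b with a ≟ b
... | yes refl = punchIn a zero , punchInᵢ≢i a zero , punchInᵢ≢i a zero
... | no a≢b = punchIn a c , punchInᵢ≢i a c , λ eq →
  -- `b` is `punchIn a b′`, so meeting `b` would force `c` to equal `b′`, which `c` skips by
  -- construction.
  punchInᵢ≢i b′ zero (punchIn-injective a c b′ (trans eq (sym (punchIn-punchOut a≢b))))
  where
  b′ = punchOut a≢b
  c  = punchIn b′ zero

-- Only edges at `v` are affected. Such an edge is no loop, so its other end keeps its old colour,
-- which `c` avoids.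
recolour-proper : ∀ {n k} (G : Graph (Fin n)) {C : Coloring (Fin n) k} → Proper G C →
  ∀ v {c} → (∀ {x} → Adj G v x → c ≢ C x) → Proper G (updateAt C v (const c))
recolour-proper G {C} proper v c≢ {x} {y} x~y eq with x ≟ v | y ≟ v
... | yes refl | yes refl = irrefl G refl x~y
... | yes refl | no y≢v   =
  c≢ x~y (trans (sym (updateAt-updates v C)) (trans eq (updateAt-minimal y v C y≢v)))
... | no x≢v   | yes refl =
  c≢ (symm G x~y)
    (trans (sym (updateAt-updates v C)) (trans (sym eq) (updateAt-minimal x v C x≢v)))
... | no x≢v   | no y≢v   =
  proper x~y
    (trans (sym (updateAt-minimal x v C x≢v)) (trans eq (updateAt-minimal y v C y≢v)))

lemma2p6 : ∀ {n k : ℕ} (G : Graph (Fin n)) → Connected G → IsChromaticNumber G k → 3 ≤ k →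
    (S : Subset n) (C₀ : Coloring (∃ λ v → v ∈ S) k) → Proper (G [ S ]) C₀ → Extendable G S C₀ →
    (∃ λ v → Pendant G v × v ∉ S) →
    ¬ IsSudoku G S C₀
lemma2p6 G _ _ 3≤k S C₀ _ _ (v , pendant , v∉S) (_ , C , (proper , extends) , unique)
  with w , only-w ← pendant⇒∃-unique-neighbour G pendant
  with c , c≢Cv , c≢Cw ← ∃-third 3≤k (C v) (C w) =
  -- Uniqueness identifies `C` with its recolouring; evaluated at `v` this says `C v` is `c`.
  c≢Cv (sym (trans (unique (proper′ , extends′) v) (updateAt-updates v C)))
  where
  proper′ : Proper G (updateAt C v (const c))
  proper′ = recolour-proper G proper v λ v~x → subst (λ x → c ≢ C x) (sym (only-w v~x)) c≢Cw

  extends′ : ∀ u (u∈S : u ∈ S) → updateAt C v (const c) u ≡ C₀ (u , u∈S)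
  extends′ u u∈S =
    -- A vertex of `S` cannot be `v`, so it keeps the colour prescribed by `C₀`.
    trans (updateAt-minimal u v C λ { refl → v∉S u∈S }) (extends u u∈S)
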